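{- Let $X$ be an $n$-premaniplex and let $\xi:\Pi(X)\to\Gamma$ be a voltage assignment such that the derived graph $X^\xi$ is a maniplex. Then $X^\xi$ is the flag graph of a polytope if and only if $$\xi(\Pi^{x,y}_{[0,m]}(X))\cap\xi(\Pi^{x,y}_{[k,n-1]}(X))=\xi(\Pi^{x,y}_{[k,m]}(X))$$ for all $k,m\in\{0,\dots,n-1\}$ and all vertices $x,y$ of $X$.
   Context: **Polytopes.** A poset is flagged if it has a least and a greatest element and all its maximal chains (flags) have the same finite cardinality, say $n+2$; it then has an order-preserving rank function onto $\{ -1,0,\dots,n\}$. Two flags are $i$-adjacent if they differ exactly in their element of rank $i$. An (abstract) $n$-polytope is a flagged poset with rank function onto $\{ -1,\dots,n\}$ such that (diamond condition) for each flag $\Phi$ and each $i\in\{0,\dots,n-1\}$ there is a unique flag that is $i$-adjacent to $\Phi$; and (strong flag connectedness) any two flags $\Phi,\Psi$ are joined by a sequence of flags, consecutive ones adjacent, all containing $\Phi\cap\Psi$. The flag graph of a polytope has the flags as vertices, with an edge of colour $i$ joining each pair of $i$-adjacent flags. An edge-coloured graph "is the flag graph of a polytope" if it is isomorphic, by a colour-preserving isomorphism, to the flag graph of some $n$-polytope. **Graphs.** Graphs may have parallel edges and semi-edges. Every edge consists of darts; a dart $d$ has an initial vertex, a terminal vertex and an inverse dart $d^{ -1}$; an edge joining two different vertices (a link) consists of two mutually inverse darts, and a semi-edge consists of a single dart $d=d^{ -1}$ with both ends at the same vertex. An $n$-premaniplex is a connected graph with edges coloured by $\{0,\dots,n-1\}$,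 all of whose edges are links or semi-edges, such that each vertex is incident to exactly one edge of each colour, and such that if $|i-j|>1$ every path of length $4$ alternating between colours $i$ and $j$ is closed. An $n$-maniplex is an $n$-regular connected simple graph (no semi-edges, no parallel edges) with a proper edge colouring with colours $\{0,\dots,n-1\}$ such that if $|i-j|>1$ the subgraph formed by edges of colours $i,j$ is a disjoint union of $4$-cycles. **Voltages.** A voltage assignment $\xi:\Pi(X)\to\Gamma$ into a group $\Gamma$ is a groupoid antimorphism from the fundamental groupoid of $X$; equivalently, it assigns to each dart $d$ an element $\xi(d)\in\Gamma$ with $\xi(d^{ -1})=\xi(d)^{ -1}$ and is extended to paths by $\xi(d_1d_2\cdots d_k)=\xi(d_k)\cdots\xi(d_1)$ (empty paths have trivial voltage). The derived graph $X^\xi$ has vertex set $V\times\Gamma$ and dart set $D\times\Gamma$ ($V$, $D$ the vertices and darts of $X$); the dart $(d,g)$, where $d$ goes from $x$ to $y$, goes from $(x,g)$ to $(y,\xi(d)g)$, has inverse $(d^{ -1},\xi(d)g)$ and has the colour of $d$. For vertices $x,y$ and a set of colours $I$, $\Pi_I^{x,y}(X)$ is the set of (homotopy classes of) paths from $x$ to $y$ using only darts with colours in $I$, and $\xi(\Pi_I^{x,y}(X))\subset\Gamma$ is the set of voltages of all such paths. $[a,b]$ denotes $\{a,a+1,\dots,b\}$, which is empty if $a>b$; thus $\Pi_\emptyset^{x,y}(X)$ contains only the empty path if $x=y$ and is empty if $x\ne y$. -}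

module Defs where

open import Level using (Level; _⊔_) renaming (suc to lsuc)
open import Algebra.Bundles using (Group)
import Algebra.Properties.Group as GroupProperties
open import Data.Fin using (Fin; zero; suc; toℕ; inject₁) renaming (_<_ to _<ᶠ_)
open import Data.Nat using (ℕ; zero; suc; _+_; _≤_; _<_; ∣_-_∣)
open import Data.Nat.DivMod using (_mod_)
open import Data.Product using (Σ; ∃; ∃-syntax; ∃!; _×_; _,_; proj₁; proj₂; swap)
open import Data.Product.Relation.Binary.Pointwise.NonDependent using (×-setoid)
open import Data.Sum using (_⊎_)
open import Function using (_∘_)
open import Function.Bundles using (Inverse; _⇔_)
import Function.Properties.Equivalence as ⇔
open import Relation.Binary.Bundles using (Setoid; Poset)
import Relation.Binary.Construct.On as On
open import Relation.Binary.Definitions using (Minimum; Maximum)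
open import Relation.Binary.PropositionalEquality as ≡ using (_≡_; _≢_; refl)
open import Relation.Nullary using (¬_)
open import Relation.Unary using (Pred; _∈_; _⊆_; _≐_; _∩_; U)
open import Relation.Unary.Relation.Binary.Equality using (≐-setoid)

private
  variable
    a b c d p ℓ : Level
    n : ℕ

subsetoid : (S : Setoid a b) → Pred (Setoid.Carrier S) p → Setoid (a ⊔ p) b
subsetoid S P = On.setoid {B = ∃ P} S proj₁

HasCardinality : Setoid a b → ℕ → Set (a ⊔ b)
HasCardinality S m = Inverse S (≡.setoid (Fin m))

------------------------------------------------------------------------
-- Edge-coloured graphs

-- Vertices and darts form setoids, so that a group given with its own
-- equality can be used for derived graphs, and flags compared as sets.
-- An edge is a pair {d , inv d}.

record Graph (n : ℕ) (a b : Level) : Set (lsuc (a ⊔ b)) where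
  field
    V : Setoid a b
    D : Setoid a b

  module V = Setoid V
  module D = Setoid D

  field
    init   : D.Carrier → V.Carrier
    term   : D.Carrier → V.Carrier
    inv    : D.Carrier → D.Carrier
    colour : D.Carrier → Fin n

    init-cong   : ∀ {d e} → d D.≈ e → init d V.≈ init e
    term-cong   : ∀ {d e} → d D.≈ e → term d V.≈ term e
    inv-cong    : ∀ {d e} → d D.≈ e → inv d D.≈ inv e
    colour-cong : ∀ {d e} → d D.≈ e → colour d ≡ colour e

    inv-involutive : ∀ d → inv (inv d) D.≈ d
    init-inv       : ∀ d → init (inv d) V.≈ term d
    colour-inv     : ∀ d → colour (inv d) ≡ colour d

  IsLink : Pred D.Carrier b
  IsLink d = ¬ (init d V.≈ term d)

  IsSemiEdge : Pred D.Carrier b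
  IsSemiEdge d = inv d D.≈ d

  SameEdge : D.Carrier → D.Carrier → Set b
  SameEdge d e = (d D.≈ e) ⊎ (d D.≈ inv e)

  -- Paths using only colours in I.  Homotopy classes are not formed:
  -- homotopic paths have equal voltages, so a set of voltages is the
  -- same whether it is taken over paths or over their classes.
  data Path (I : Pred (Fin n) p) : V.Carrier → V.Carrier → Set (a ⊔ b ⊔ p) where
    nil  : ∀ {x y} → x V.≈ y → Path I x y
    cons : ∀ {x y} (d : D.Carrier) → x V.≈ init d → colour d ∈ I →
           Path I (term d) y → Path I x y

  record IsConnected : Set (a ⊔ b) where
    field
      vertex : V.Carrier
      path   : ∀ x y → Path U x y

  DartsFrom : V.Carrier → Setoid (a ⊔ b) b
  DartsFrom x = subsetoid D (λ d → init d V.≈ x)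

record IsPremaniplex {n} (X : Graph n a b) : Set (a ⊔ b) where
  open Graph X
  field
    connected       : IsConnected
    link⊎semiEdge   : ∀ d → IsLink d ⊎ IsSemiEdge d
    uniqueEdge      : ∀ x i → ∃[ d ] (init d V.≈ x × colour d ≡ i ×
                        (∀ e → init e V.≈ x → colour e ≡ i → SameEdge e d))
    alternateClosed : ∀ (i j : Fin n) → 1 < ∣ toℕ i - toℕ j ∣ →
                      ∀ d₁ d₂ d₃ d₄ →
                      colour d₁ ≡ i → colour d₂ ≡ j → colour d₃ ≡ i → colour d₄ ≡ j →
                      term d₁ V.≈ init d₂ → term d₂ V.≈ init d₃ → term d₃ V.≈ init d₄ →
                      term d₄ V.≈ init d₁

-- The connected component of x in the subgraph of edges with colours
-- in {i , j} is a 4-cycle: by `whole`, the cycle contains every edge of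
-- that subgraph meeting it.

record ComponentIsFourCycle {n} (M : Graph n a b) (i j : Fin n) (x : Graph.V.Carrier M)
       : Set (a ⊔ b) where
  open Graph M
  field
    dart     : Fin 4 → D.Carrier
    coloured : ∀ k → colour (dart k) ≡ i ⊎ colour (dart k) ≡ j
    start    : init (dart zero) V.≈ x
    closed   : ∀ k → term (dart k) V.≈ init (dart (suc (toℕ k) mod 4))
    distinct : ∀ k l → init (dart k) V.≈ init (dart l) → k ≡ l
    whole    : ∀ k e → init e V.≈ init (dart k) → colour e ≡ i ⊎ colour e ≡ j →
               ∃[ l ] SameEdge e (dart l)

record IsManiplex {n} (M : Graph n a b) : Set (a ⊔ b) where
  open Graph M
  field
    connected       : IsConnected
    noSemiEdges     : ∀ d → ¬ IsSemiEdge d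
    allLinks        : ∀ d → IsLink d
    noParallelEdges : ∀ d e → init d V.≈ init e → term d V.≈ term e → SameEdge d e
    regular         : ∀ x → HasCardinality (DartsFrom x) n
    proper          : ∀ d e → init d V.≈ init e → colour d ≡ colour e → SameEdge d e
    fourCycles      : ∀ (i j : Fin n) → 1 < ∣ toℕ i - toℕ j ∣ →
                      ∀ x → ComponentIsFourCycle M i j x

record ColouredIsomorphism {n} (G : Graph n a b) (H : Graph n c d)
       : Set (a ⊔ b ⊔ c ⊔ d) where
  private
    module G = Graph G
    module H = Graph H
  field
    onVertices : Inverse G.V H.V
    onDarts    : Inverse G.D H.D

  vertexMap : G.V.Carrier → H.V.Carrier
  vertexMap = Inverse.to onVertices

  dartMap : G.D.Carrier → H.D.Carrier
  dartMap = Inverse.to onDarts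

  field
    init-preserved   : ∀ e → H.init (dartMap e) H.V.≈ vertexMap (G.init e)
    term-preserved   : ∀ e → H.term (dartMap e) H.V.≈ vertexMap (G.term e)
    inv-preserved    : ∀ e → H.inv (dartMap e) H.D.≈ dartMap (G.inv e)
    colour-preserved : ∀ e → H.colour (dartMap e) ≡ G.colour e

------------------------------------------------------------------------
-- Voltages

record VoltageAssignment {n} (X : Graph n a b) (Γ : Group c d) : Set (a ⊔ b ⊔ c ⊔ d) where
  open Graph X
  private module Γ = Group Γ
  field
    voltage      : D.Carrier → Γ.Carrier
    voltage-cong : ∀ {d e} → d D.≈ e → voltage d Γ.≈ voltage e
    voltage-inv  : ∀ d → voltage (inv d) Γ.≈ voltage d Γ.⁻¹

  pathVoltage : ∀ {I : Pred (Fin n) p} {x y} → Path I x y → Γ.Carrier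
  pathVoltage (nil _)        = Γ.ε
  pathVoltage (cons d _ _ w) = pathVoltage w Γ.∙ voltage d

  Voltages : Pred (Fin n) p → V.Carrier → V.Carrier → Pred Γ.Carrier (a ⊔ b ⊔ d ⊔ p)
  Voltages I x y g = Σ (Path I x y) λ w → pathVoltage w Γ.≈ g

[_⋯_] : ℕ → ℕ → Pred (Fin n) _
[ k ⋯ m ] i = k ≤ toℕ i × toℕ i ≤ m

module _ {n} (X : Graph n a b) (Γ : Group a b) (ξ : VoltageAssignment X Γ) where
  open Graph X
  open VoltageAssignment ξ
  private
    module Γ = Group Γ
    open GroupProperties Γ using (\\-leftDividesʳ)

    cancel : ∀ d g → voltage (inv d) Γ.∙ (voltage d Γ.∙ g) Γ.≈ g
    cancel d g = Γ.trans (Γ.∙-congʳ (voltage-inv d)) (\\-leftDividesʳ (voltage d) g)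

  derivedGraph : Graph n a b
  derivedGraph = record
    { V              = ×-setoid V Γ.setoid
    ; D              = ×-setoid D Γ.setoid
    ; init           = λ (d , g) → init d , g
    ; term           = λ (d , g) → term d , voltage d Γ.∙ g
    ; inv            = λ (d , g) → inv d , voltage d Γ.∙ g
    ; colour         = λ (d , g) → colour d
    ; init-cong      = λ (p , q) → init-cong p , q
    ; term-cong      = λ (p , q) → term-cong p , Γ.∙-cong (voltage-cong p) q
    ; inv-cong       = λ (p , q) → inv-cong p , Γ.∙-cong (voltage-cong p) q
    ; colour-cong    = λ (p , q) → colour-cong p
    ; inv-involutive = λ (d , g) → inv-involutive d , cancel d g
    ; init-inv       = λ (d , g) → init-inv d , Γ.refl
    ; colour-inv     = λ (d , g) → colour-inv d
    }

------------------------------------------------------------------------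
-- Polytopes

module _ (P : Poset ℓ ℓ ℓ) where
  open Poset P using (Carrier) renaming (_≤_ to _⊑_)

  IsChain : Pred Carrier ℓ → Set ℓ
  IsChain C = ∀ {x y} → x ∈ C → y ∈ C → x ⊑ y ⊎ y ⊑ x

  -- Such a C is automatically closed under the equality of P, since the
  -- closure of a chain under that equality is again a chain.
  IsMaximalChain : Pred Carrier ℓ → Set (lsuc ℓ)
  IsMaximalChain C = IsChain C × (∀ C′ → IsChain C′ → C ⊆ C′ → C′ ⊆ C)

  record Flag : Set (lsuc ℓ) where
    field
      faces          : Pred Carrier ℓ
      isMaximalChain : IsMaximalChain faces

open Flag public using (faces)

-- Ranks are shifted by one: the value r : Fin (2 + n) of the rank
-- function stands for the rank r - 1 ∈ {-1,…,n}.  Since each flag has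
-- 2 + n elements and rank is strictly increasing, the rank of an element
-- of a flag is its position in that flag, so the field is not a choice.

record FlaggedPoset (n : ℕ) (ℓ : Level) : Set (lsuc ℓ) where
  field
    poset : Poset ℓ ℓ ℓ

  open Poset poset public using (Carrier; _≈_) renaming (_≤_ to _⊑_)

  field
    least            : Carrier
    least-minimum    : Minimum _⊑_ least
    greatest         : Carrier
    greatest-maximum : Maximum _⊑_ greatest
    flag-cardinality : ∀ (Φ : Flag poset) →
                       HasCardinality (subsetoid (Poset.Eq.setoid poset) (faces Φ)) (2 + n)
    rank             : Carrier → Fin (2 + n)
    rank-cong        : ∀ {x y} → x ≈ y → rank x ≡ rank y
    rank-mono        : ∀ {x y} → x ⊑ y → ¬ (x ≈ y) → rank x <ᶠ rank y
    rank-onto        : ∀ r → ∃[ x ] rank x ≡ r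

  _≐ᶠ_ : Flag poset → Flag poset → Set ℓ
  Φ ≐ᶠ Ψ = faces Φ ≐ faces Ψ

  -- suc (inject₁ i) is the shifted form of rank i.
  Adjacent : Fin n → Flag poset → Flag poset → Set ℓ
  Adjacent i Φ Ψ =
    (∀ x → rank x ≢ suc (inject₁ i) → x ∈ faces Φ ⇔ x ∈ faces Ψ) × ¬ (Φ ≐ᶠ Ψ)

  -- Sequences of flags, all containing S, consecutive ones adjacent.
  data FlagSequence (S : Pred Carrier ℓ) : Flag poset → Flag poset → Set (lsuc ℓ) where
    stop : ∀ {Φ Ψ} → S ⊆ faces Φ → Φ ≐ᶠ Ψ → FlagSequence S Φ Ψ
    step : ∀ {Φ Φ′ Ψ} → S ⊆ faces Φ → ∃[ i ] Adjacent i Φ Φ′ →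
           FlagSequence S Φ′ Ψ → FlagSequence S Φ Ψ

record Polytope (n : ℕ) (ℓ : Level) : Set (lsuc ℓ) where
  field
    flaggedPoset : FlaggedPoset n ℓ

  open FlaggedPoset flaggedPoset public

  field
    diamond               : ∀ Φ i → ∃! _≐ᶠ_ (Adjacent i Φ)
    stronglyFlagConnected : ∀ Φ Ψ → FlagSequence (faces Φ ∩ faces Ψ) Φ Ψ

module _ (𝒫 : Polytope n ℓ) where
  open Polytope 𝒫
  private
    flags : Setoid (lsuc ℓ) ℓ
    flags = On.setoid {B = Flag poset} (≐-setoid Carrier ℓ) faces

    adjacentPairs : Setoid (lsuc ℓ) ℓ
    adjacentPairs =
      subsetoid (×-setoid (≡.setoid (Fin n)) (×-setoid flags flags))
        (λ (i , Φ , Ψ) → Adjacent i Φ Ψ)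

  flagGraph : Graph n (lsuc ℓ) ℓ
  flagGraph = record
    { V              = flags
    ; D              = adjacentPairs
    ; init           = λ ((i , Φ , Ψ) , _) → Φ
    ; term           = λ ((i , Φ , Ψ) , _) → Ψ
    ; inv            = λ ((i , Φ , Ψ) , (agree , differ)) →
                         (i , Ψ , Φ) , ((λ x r → ⇔.sym (agree x r)) , differ ∘ swap)
    ; colour         = λ ((i , Φ , Ψ) , _) → i
    ; init-cong      = λ (_ , p , _) → p
    ; term-cong      = λ (_ , _ , q) → q
    ; inv-cong       = λ (r , p , q) → r , q , p
    ; colour-cong    = proj₁
    ; inv-involutive = λ e → Setoid.refl adjacentPairs {e}
    ; init-inv       = λ ((i , Φ , Ψ) , _) → Setoid.refl flags {Ψ}
    ; colour-inv     = λ _ → refl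
    }

IsFlagGraphOfPolytope : Graph n ℓ ℓ → Set (lsuc ℓ)
IsFlagGraphOfPolytope {n} {ℓ} G =
  Σ (Polytope n ℓ) λ 𝒫 → ColouredIsomorphism G (flagGraph 𝒫)

-- A path in the derived graph from (x , g) to (y , h) is a path of X
-- with voltage h g⁻¹, so the condition on voltages says that vertices of
-- the derived graph M joined by a path with colours in [0,m] and by one
-- with colours in [k,n-1] are joined by one with colours in [k,m].
--
-- In a polytope, flags joined in both ways share their faces of all
-- ranks outside [k,m], so the flags of a sequence provided by strong
-- connectedness are adjacent at ranks in [k,m] only.
--
-- Conversely, the faces of rank r of M are its components without the
-- edges of colour r, two faces being incident when they meet.  As
-- colours at distance more than 1 commute, a path avoiding r can be
-- sorted into colours below r and colours above r; hence incidence is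
-- transitive and every chain of faces has a common vertex.  The
-- intersection condition is needed for the rest: with it, any two
-- vertices v, w are joined by a path using only those colours r for
-- which no path from v to w avoids r.  This gives the diamond condition,
-- strong connectedness, and that a vertex is determined by its faces.

module Submission where

open import Defs
open import Level using (Level)
open import Algebra.Bundles using (Group)
import Algebra.Properties.Group as GroupProperties
open import Axiom.ExcludedMiddle using (ExcludedMiddle)
open import Data.Fin using (Fin; zero; suc; toℕ; fromℕ; fromℕ<; inject₁; punchOut)
open import Data.Fin.Properties using (any?; toℕ<n; toℕ-injective; toℕ-fromℕ; toℕ-fromℕ<; toℕ-inject₁; punchOut-injective; injective⇒≤)
import Data.Fin.Properties as Fin
open import Data.Nat using (ℕ; zero; suc; _+_; _∸_; _≤_; _<_; ∣_-_∣; z≤n; s≤s; s≤s⁻¹)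
open import Data.Nat.DivMod using (_mod_)
import Data.Nat.Properties as ℕ
open import Data.Product using (Σ; ∃-syntax; ∃₂; _×_; _,_; proj₁; proj₂)
open import Data.Sum using (_⊎_; inj₁; inj₂; [_,_]′; swap)
open import Function using (_∘_; id)
open import Function.Bundles using (Inverse; Equivalence; _⇔_; mk⇔)
open import Function.Definitions using (Injective)
import Function.Properties.Equivalence as ⇔
open import Relation.Binary.Bundles using (Poset)
open import Relation.Binary.PropositionalEquality using (_≡_; _≢_; refl; sym; trans; cong; subst)
open import Relation.Nullary using (¬_; Dec; yes; no; contradiction; _×-dec_)
open import Relation.Nullary.Decidable using (decidable-stable)
open import Relation.Unary.Properties using (≐-sym; ≐-trans)
open import Relation.Unary using (Pred; _∈_; _⊆_; _∩_; _≐_)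

private
  variable
    a b p q q′ ℓ : Level
    n : ℕ

-- Finite sets and sets of colours.

injective⇒surjective : (f : Fin n → Fin n) → Injective _≡_ _≡_ f → ∀ y → ∃[ x ] f x ≡ y
injective⇒surjective {suc n} f f-injective y with any? (λ x → f x Fin.≟ y)
... | yes found = found
-- Deleting the missed value `y` from the codomain would inject `Fin (suc n)` into `Fin n`.
... | no missed = contradiction (injective⇒≤ {f = λ x → punchOut (y≢f x)} punch-injective) ℕ.1+n≰n
  where
  y≢f : ∀ x → y ≢ f x
  y≢f x y≡fx = missed (x , sym y≡fx)

  punch-injective : Injective _≡_ _≡_ (λ x → punchOut (y≢f x))
  punch-injective {x} {z} eq = f-injective (punchOut-injective (y≢f x) (y≢f z) eq)

-- Ranks are shifted by one, as in FlaggedPoset: colour c has rank 1 + c.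

Avoid Below Above : ℕ → Pred (Fin n) _
Avoid r c = suc (toℕ c) ≢ r
Below r c = suc (toℕ c) < r
Above r c = r < suc (toℕ c)

module _ {r s : ℕ} where

  Below⊆Avoid : r ≤ s → Below {n} r ⊆ Avoid s
  Below⊆Avoid r≤s c<r = ℕ.<⇒≢ (ℕ.<-≤-trans c<r r≤s)

  Above⊆Avoid : r ≤ s → Above {n} s ⊆ Avoid r
  Above⊆Avoid r≤s s<c = ℕ.>⇒≢ (ℕ.≤-<-trans r≤s s<c)

Avoid⊆Below⊎Above : ∀ r (c : Fin n) → c ∈ Avoid r → c ∈ Below r ⊎ c ∈ Above r
Avoid⊆Below⊎Above r c c≢r with ℕ.≤-<-connex r (suc (toℕ c))
... | inj₁ r≤c = inj₂ (ℕ.≤∧≢⇒< r≤c (c≢r ∘ sym))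
... | inj₂ c<r = inj₁ c<r

Far : Pred (Fin n) p → Pred (Fin n) q → Set _
Far I J = ∀ {i j} → i ∈ I → j ∈ J → 1 < ∣ toℕ i - toℕ j ∣

-- Rank `r` lies strictly between the ranks of the two colours, so these differ by at least 2.
Below-Far-Above : ∀ r → Far {n} (Below r) (Above r)
Below-Far-Above r {i} {j} i<r r<j =
  subst (1 <_) (sym (ℕ.m≤n⇒∣m-n∣≡n∸m (ℕ.≤-trans (ℕ.m≤n+m _ 2) 2+i≤j)))
    (ℕ.m+n≤o⇒m≤o∸n 2 2+i≤j)
  where
  2+i≤j : 2 + toℕ i ≤ toℕ j
  2+i≤j = ℕ.≤-trans i<r (s≤s⁻¹ r<j)

Far-sym : {I : Pred (Fin n) p} {J : Pred (Fin n) q} → Far I J → Far J I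
Far-sym far {j} {i} j∈J i∈I = subst (1 <_) (ℕ.∣-∣-comm (toℕ i) (toℕ j)) (far i∈I j∈J)

-- Paths in coloured graphs and their transport along isomorphisms.

module Paths (G : Graph n a b) where
  open Graph G

  private
    variable
      I : Pred (Fin n) p
      J : Pred (Fin n) q
      x y z : V.Carrier

  weaken : I ⊆ J → Path I x y → Path J x y
  weaken I⊆J (nil x≈y)       = nil x≈y
  weaken I⊆J (cons d x≈ i w) = cons d x≈ (I⊆J i) (weaken I⊆J w)

  Path-respˡ : x V.≈ y → Path I x z → Path I y z
  Path-respˡ x≈y (nil x≈z)       = nil (V.trans (V.sym x≈y) x≈z)
  Path-respˡ x≈y (cons d x≈ i w) = cons d (V.trans (V.sym x≈y) x≈) i w

  infixr 5 _++_

  _++_ : Path I x y → Path I y z → Path I x z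
  nil x≈y       ++ v = Path-respˡ (V.sym x≈y) v
  cons d x≈ i w ++ v = cons d x≈ i (w ++ v)

  [_] : (d : D.Carrier) → colour d ∈ I → Path I (init d) (term d)
  [ d ] i = cons d V.refl i (nil V.refl)

  term-inv : ∀ d → term (inv d) V.≈ init d
  term-inv d = V.trans (V.sym (init-inv (inv d))) (init-cong (inv-involutive d))

  reverse : Path I x y → Path I y x
  reverse         (nil x≈y)       = nil (V.sym x≈y)
  reverse {I = I} (cons d x≈ i w) =
    reverse w ++ cons (inv d) (V.sym (init-inv d)) (subst I (sym (colour-inv d)) i)
                   (nil (V.trans (term-inv d) (V.sym x≈)))

  empty-path : (∀ c → ¬ c ∈ I) → Path I x y → x V.≈ y
  empty-path ∉I (nil x≈y)      = x≈y
  empty-path ∉I (cons d _ i _) = contradiction i (∉I (colour d))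

module Isomorphisms {c d} {G : Graph n a b} {H : Graph n c d} (iso : ColouredIsomorphism G H) where
  open ColouredIsomorphism iso
  private
    module G = Graph G
    module H = Graph H
    module onV = Inverse onVertices
    module onD = Inverse onDarts

  preserves-path : {I : Pred (Fin n) p} {x y : G.V.Carrier} →
                   G.Path I x y → H.Path I (vertexMap x) (vertexMap y)
  preserves-path (G.nil x≈y) = H.nil (onV.to-cong x≈y)
  preserves-path {I = I} (G.cons e x≈ i w) =
    H.cons (dartMap e) (H.V.trans (onV.to-cong x≈) (H.V.sym (init-preserved e)))
      (subst I (sym (colour-preserved e)) i)
      (Paths.Path-respˡ H (H.V.sym (term-preserved e)) (preserves-path w))

  vertexMap-injective : ∀ {x y} → vertexMap x H.V.≈ vertexMap y → x G.V.≈ y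
  vertexMap-injective {x} {y} eq =
    G.V.trans (G.V.sym (onV.strictlyInverseʳ x)) (G.V.trans (onV.from-cong eq) (onV.strictlyInverseʳ y))

  reflects-path : {I : Pred (Fin n) p} {x′ y′ : H.V.Carrier} → H.Path I x′ y′ →
                  ∀ {x y} → x′ H.V.≈ vertexMap x → y′ H.V.≈ vertexMap y → G.Path I x y
  reflects-path (H.nil x′≈y′) x′≈ y′≈ =
    G.nil (vertexMap-injective (H.V.trans (H.V.sym x′≈) (H.V.trans x′≈y′ y′≈)))
  reflects-path {I = I} (H.cons e x′≈e i w) x′≈ y′≈ =
    G.cons e′ (vertexMap-injective
                (H.V.trans (H.V.sym x′≈) (H.V.trans x′≈e
                  (H.V.trans (H.V.sym (H.init-cong to-e′≈e)) (init-preserved e′)))))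
      (subst I (trans (H.colour-cong (H.D.sym to-e′≈e)) (colour-preserved e′)) i)
      (reflects-path w (H.V.trans (H.term-cong (H.D.sym to-e′≈e)) (term-preserved e′)) y′≈)
    where
    e′ = onD.from e

    to-e′≈e : dartMap e′ H.D.≈ e
    to-e′≈e = onD.strictlyInverseˡ e

-- Commuting colours in a maniplex.

module Maniplexes {G : Graph n a b} (maniplex : IsManiplex G) where
  open Graph G
  open IsManiplex maniplex public
  open IsConnected connected public using (vertex; path)
  open Paths G

  -- `proper` only identifies the edges; the opposite orientation would make `e` a dart with equal
  -- ends.
  dart-unique : ∀ {d e} → init d V.≈ init e → colour d ≡ colour e → d D.≈ e
  dart-unique {d} {e} p q with proper d e p q
  ... | inj₁ d≈e  = d≈e
  ... | inj₂ d≈e⁻ = contradiction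
    (V.trans (V.sym p) (V.trans (init-cong d≈e⁻) (init-inv e))) (allLinks e)

  coloured-dart : ∀ x i → ∃[ d ] (init d V.≈ x × colour d ≡ i)
  coloured-dart x i =
    let open Inverse (regular x)
        j , eq = injective⇒surjective (λ j → colour (proj₁ (from j)))
                   (λ {j} {k} eq → trans (sym (strictlyInverseˡ j)) (trans
                      (to-cong (dart-unique (V.trans (proj₂ (from j)) (V.sym (proj₂ (from k)))) eq))
                      (strictlyInverseˡ k)))
                   i
    in  proj₁ (from j) , proj₂ (from j) , eq

  Square : D.Carrier → Fin n → V.Carrier → Set _
  Square d i z = ∃₂ λ e′ d′ → init e′ V.≈ init d × colour e′ ≡ i × term e′ V.≈ init d′ ×
                              colour d′ ≡ colour d × term d′ V.≈ z

  module _ {i j : Fin n} {x : V.Carrier} (cycle : ComponentIsFourCycle G i j x) where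
    open ComponentIsFourCycle cycle

    private
      next : Fin 4 → Fin 4
      next k = suc (toℕ k) mod 4

      next²≢id : ∀ k → k ≢ next (next k)
      next²≢id zero                ()
      next²≢id (suc zero)          ()
      next²≢id (suc (suc zero))    ()
      next²≢id (suc (suc (suc zero))) ()

    -- A repeated colour would make the next dart the inverse of `dart k`, and two steps round the
    -- cycle would return to the same vertex.
    colours-alternate : ∀ k → colour (dart (next k)) ≢ colour (dart k)
    colours-alternate k eq = next²≢id k (distinct k (next (next k)) (V.trans
      (V.sym (term-inv (dart k)))
      (V.trans (term-cong (dart-unique (V.trans (init-inv (dart k)) (closed k))
                                       (trans (colour-inv (dart k)) (sym eq))))
               (closed (next k)))))

    colour-after-i : ∀ k → colour (dart k) ≡ i → colour (dart (next k)) ≡ j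
    colour-after-i k eq with coloured (next k)
    ... | inj₁ eq′ = contradiction (trans eq′ (sym eq)) (colours-alternate k)
    ... | inj₂ eq′ = eq′

    colour-after-j : ∀ k → colour (dart k) ≡ j → colour (dart (next k)) ≡ i
    colour-after-j k eq with coloured (next k)
    ... | inj₁ eq′ = eq′
    ... | inj₂ eq′ = contradiction (trans eq′ (sym eq)) (colours-alternate k)

  -- In the 4-cycle through `init e`, the darts `d` and `e` form one way from `init d` to `term e`;
  -- the other way carries the same colours in opposite order.
  square : ∀ d e → 1 < ∣ toℕ (colour e) - toℕ (colour d) ∣ → term d V.≈ init e →
           Square d (colour e) (term e)
  square d e far d→e = from-colour (coloured zero)
    where
    i = colour e
    j = colour d
    cycle = fourCycles i j far (init e)
    open ComponentIsFourCycle cycle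

    k₀ k₁ k₂ k₃ : Fin 4
    k₀ = zero
    k₁ = suc zero
    k₂ = suc (suc zero)
    k₃ = suc (suc (suc zero))

    same-term : ∀ {d e} → init d V.≈ init e → colour d ≡ colour e → term d V.≈ term e
    same-term p q = term-cong (dart-unique p q)

    init-inv-d : init (inv d) V.≈ init (dart k₀)
    init-inv-d = V.trans (init-inv d) (V.trans d→e (V.sym start))

    init-inv-last : init (inv (dart k₃)) V.≈ init (dart k₀)
    init-inv-last = V.trans (init-inv (dart k₃)) (closed k₃)

    -- The cycle through init e starts with e in the first case, and
    -- ends with the inverse of e in the second.
    from-colour : colour (dart k₀) ≡ i ⊎ colour (dart k₀) ≡ j → Square d i (term e)
    from-colour (inj₁ c₀) =
      inv (dart k₂) , inv (dart k₁) ,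
      V.trans (init-inv (dart k₂)) (V.trans (closed k₂) (V.trans (V.sym (term-inv (dart k₃)))
        (V.trans (same-term (V.trans init-inv-last (V.sym init-inv-d))
                            (trans (colour-inv (dart k₃)) (trans c₃ (sym (colour-inv d)))))
                 (term-inv d)))) ,
      trans (colour-inv (dart k₂)) c₂ ,
      V.trans (term-inv (dart k₂)) (V.trans (V.sym (closed k₁)) (V.sym (init-inv (dart k₁)))) ,
      trans (colour-inv (dart k₁)) c₁ ,
      V.trans (term-inv (dart k₁)) (V.trans (V.sym (closed k₀)) (same-term start c₀))
      where
      c₁ = colour-after-i cycle k₀ c₀
      c₂ = colour-after-j cycle k₁ c₁
      c₃ = colour-after-i cycle k₂ c₂
    from-colour (inj₂ c₀) =
      dart k₁ , dart k₂ ,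
      V.trans (V.sym (closed k₀)) (V.trans
        (same-term (V.sym init-inv-d) (trans c₀ (sym (colour-inv d))))
        (term-inv d)) ,
      c₁ ,
      closed k₁ ,
      c₂ ,
      V.trans (closed k₂) (V.trans (V.sym (term-inv (dart k₃)))
        (same-term (V.trans init-inv-last start) (trans (colour-inv (dart k₃)) c₃)))
      where
      c₁ = colour-after-j cycle k₀ c₀
      c₂ = colour-after-i cycle k₁ c₁
      c₃ = colour-after-j cycle k₂ c₂

  private
    variable
      I : Pred (Fin n) p
      J : Pred (Fin n) q
      x y : V.Carrier

  commute : Far I J → ∀ {d} → colour d ∈ J → term d V.≈ x → Path I x y →
            ∃[ d′ ] (colour d′ ∈ J × term d′ V.≈ y × Path I (init d) (init d′))
  commute far {d} d∈J d→x (nil x≈y) = d , d∈J , V.trans d→x x≈y , nil V.refl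
  commute {I = I} {J = J} far {d} d∈J d→x (cons e x≈ e∈I w)
    with e′ , d′ , e′≈ , ce′ , e′→d′ , cd′ , d′→ ← square d e (far e∈I d∈J) (V.trans d→x x≈)
    with d″ , d″∈J , d″→ , w′ ← commute far (subst J (sym cd′) d∈J) d′→ w
    = d″ , d″∈J , d″→ ,
      cons e′ (V.sym e′≈) (subst I (sym ce′) e∈I) (Path-respˡ (V.sym e′→d′) w′)

  -- Insertion sort: the tail is sorted first, then a leading dart with colour in `J` is pushed past
  -- the `I` part, one square at a time, by `commute`.
  split : {K : Pred (Fin n) q′} → Far I J → (∀ c → c ∈ K → c ∈ I ⊎ c ∈ J) →
          Path K x y → ∃[ z ] (Path I x z × Path J z y)
  split far K⊆ (nil x≈y) = _ , nil x≈y , nil V.refl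
  split far K⊆ (cons d x≈ k w) with split far K⊆ w | K⊆ _ k
  ... | z , u , v | inj₁ i = z , cons d x≈ i u , v
  ... | z , u , v | inj₂ j with d′ , d′∈J , d′→z , u′ ← commute far j V.refl u
    = init d′ , Path-respˡ (V.sym x≈) u′ , cons d′ V.refl d′∈J (Path-respˡ (V.sym d′→z) v)

  split-below-above : ∀ r → Path (Avoid r) x y → ∃[ z ] (Path (Below r) x z × Path (Above r) z y)
  split-below-above r = split (Below-Far-Above r) (Avoid⊆Below⊎Above r)

  split-above-below : ∀ r → Path (Avoid r) x y → ∃[ z ] (Path (Above r) x z × Path (Below r) z y)
  split-above-below r =
    split (Far-sym {I = Below r} {J = Above r} (Below-Far-Above r)) (λ c → swap ∘ Avoid⊆Below⊎Above r c)

  connect : (∀ c → c ∈ I) → Path I x y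
  connect all = weaken (λ _ → all _) (path _ _)

-- Only one inclusion is stated, since the other holds in every graph by weakening.
PathIntersection : Graph n a b → Set _
PathIntersection {n} G = ∀ (k m : Fin n) v w →
  Path [ 0 ⋯ toℕ m ] v w → Path [ toℕ k ⋯ n ∸ 1 ] v w → Path [ toℕ k ⋯ toℕ m ] v w
  where open Graph G using (Path)

-- The poset of faces of a maniplex.

module FacePoset {G : Graph n ℓ ℓ} (maniplex : IsManiplex G) (em : ExcludedMiddle ℓ) where
  open Graph G
  open Paths G
  open Maniplexes maniplex

  -- (r , v) is the face of (shifted) rank r in the flag v, that is, the
  -- component of v in the graph without the edges of colour r - 1.
  Face : Set ℓ
  Face = Fin (2 + n) × V.Carrier

  infix 4 _≈ᶠ_ _⊑ᶠ_

  _≈ᶠ_ _⊑ᶠ_ : Face → Face → Set ℓ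
  (r , v) ≈ᶠ (s , w) = r ≡ s × Path (Avoid (toℕ r)) v w
  (r , v) ⊑ᶠ (s , w) = toℕ r ≤ toℕ s × ∃[ u ] (Path (Avoid (toℕ r)) v u × Path (Avoid (toℕ s)) u w)

  ⊑-reflexive : ∀ {x y} → x ≈ᶠ y → x ⊑ᶠ y
  ⊑-reflexive (refl , w) = ℕ.≤-refl , _ , w , nil V.refl

  -- A path avoiding the middle rank s is sorted into a part above s,
  -- which avoids the lower rank, and a part below s, which avoids the
  -- upper one.
  ⊑-trans : ∀ {x y z} → x ⊑ᶠ y → y ⊑ᶠ z → x ⊑ᶠ z
  ⊑-trans {y = s , _} (r≤s , _ , p , p′) (s≤t , _ , q , q′)
    with u , above , below ← split-above-below (toℕ s) (p′ ++ q)
    = ℕ.≤-trans r≤s s≤t , u ,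
      p ++ weaken (λ {c} → Above⊆Avoid r≤s {c}) above , weaken (λ {c} → Below⊆Avoid s≤t {c}) below ++ q′

  ⊑-flip : ∀ {x y} → x ⊑ᶠ y → toℕ (proj₁ y) ≤ toℕ (proj₁ x) → y ⊑ᶠ x
  ⊑-flip (_ , u , p , q) s≤r = s≤r , u , reverse q , reverse p

  ⊑∧≡⇒≈ : ∀ {x y} → x ⊑ᶠ y → proj₁ x ≡ proj₁ y → x ≈ᶠ y
  ⊑∧≡⇒≈ (_ , _ , p , q) refl = refl , p ++ q

  facePoset : Poset ℓ ℓ ℓ
  facePoset = record
    { Carrier        = Face
    ; _≈_            = _≈ᶠ_
    ; _≤_            = _⊑ᶠ_
    ; isPartialOrder = record
      { isPreorder = record
        { isEquivalence = record
          { refl  = refl , nil V.refl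
          ; sym   = λ { (refl , w) → refl , reverse w }
          ; trans = λ { (refl , v) (refl , w) → refl , v ++ w }
          }
        ; reflexive = ⊑-reflexive
        ; trans     = ⊑-trans
        }
      ; antisym = λ x⊑y y⊑x → ⊑∧≡⇒≈ x⊑y (toℕ-injective (ℕ.≤-antisym (proj₁ x⊑y) (proj₁ y⊑x)))
      }
    }

  facesOf : V.Carrier → Pred Face ℓ
  facesOf v (r , w) = Path (Avoid (toℕ r)) w v

  facesOf-isChain : ∀ v → IsChain facePoset (facesOf v)
  facesOf-isChain v {r , _} {s , _} p q with ℕ.≤-total (toℕ r) (toℕ s)
  ... | inj₁ r≤s = inj₁ (r≤s , v , p , reverse q)
  ... | inj₂ s≤r = inj₂ (s≤r , v , q , reverse p)

  -- A face of a larger chain is comparable with the face of `v` of the same rank, and comparable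
  -- faces of equal rank are equal.
  facesOf-isMaximal : ∀ v → IsMaximalChain facePoset (facesOf v)
  facesOf-isMaximal v = facesOf-isChain v , λ C C-chain facesOf⊆C {(r , w)} w∈C →
    proj₂ ([ (λ ⊑ → ⊑∧≡⇒≈ ⊑ refl) , (λ ⊒ → ⊑∧≡⇒≈ (⊑-flip ⊒ ℕ.≤-refl) refl) ]′
             (C-chain w∈C (facesOf⊆C {r , v} (nil V.refl))))

  flag : V.Carrier → Flag facePoset
  flag v = record { faces = facesOf v ; isMaximalChain = facesOf-isMaximal v }

  facesOf-cong : ∀ {v w} → v V.≈ w → facesOf v ≐ facesOf w
  facesOf-cong v≈w = (_++ nil v≈w) , (_++ nil (V.sym v≈w))

  module _ {C : Pred Face ℓ} (C-chain : IsChain facePoset C) where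

    -- (s , v) is the largest face of C of rank less than m, or the least
    -- face of the poset if C has none.
    record IncidentBelow (m : ℕ) : Set ℓ where
      field
        s     : Fin (2 + n)
        v     : V.Carrier
        below : ∀ t w → (t , w) ∈ C → toℕ t < m → toℕ t ≤ toℕ s × (t , w) ∈ facesOf v
        above : ∀ t w → (t , w) ∈ C → m ≤ toℕ t → (s , v) ⊑ᶠ (t , w)

    chain-⊑ : ∀ {x y} → x ∈ C → y ∈ C → toℕ (proj₁ x) ≤ toℕ (proj₁ y) → x ⊑ᶠ y
    chain-⊑ x∈C y∈C r≤s = [ id , (λ y⊑x → ⊑-flip y⊑x r≤s) ]′ (C-chain x∈C y∈C)

    -- A face of `C` of rank `m`, if there is one, meets `(s , v)`. The path from `v` to a common
    -- vertex is sorted at rank `s`: its part above `s` stays in all smaller faces of `C`, its part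
    -- below `s` stays in the new face, so the vertex `y` between them lies in all of these.
    incident-step : ∀ {m} → IncidentBelow m → IncidentBelow (suc m)
    incident-step {m} incident
      with em {∃₂ λ t w → (t , w) ∈ C × toℕ t ≡ m}
    ... | no none = record
      { s     = s
      ; v     = v
      ; below = λ t w ∈C t≤m → below t w ∈C (ℕ.≤∧≢⇒< (s≤s⁻¹ t≤m) (λ t≡m → none (t , w , ∈C , t≡m)))
      ; above = λ t w ∈C m<t → above t w ∈C (ℕ.<⇒≤ m<t)
      }
      where open IncidentBelow incident
    ... | yes (t₀ , w₀ , w₀∈C , refl)
      with s≤t₀ , x , v-x , x-w₀ ← IncidentBelow.above incident t₀ w₀ w₀∈C ℕ.≤-refl
      with y , v-y , y-x ← split-above-below (toℕ (IncidentBelow.s incident)) v-x = record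
      { s     = t₀
      ; v     = y
      ; below = below′
      ; above = λ t w ∈C t₀<t → ⊑-trans (⊑-reflexive {t₀ , y} (refl , y-w₀)) (chain-⊑ w₀∈C ∈C (ℕ.<⇒≤ t₀<t))
      }
      where
      open IncidentBelow incident

      y-w₀ : Path (Avoid (toℕ t₀)) y w₀
      y-w₀ = weaken (λ {c} → Below⊆Avoid s≤t₀ {c}) y-x ++ x-w₀

      below′ : ∀ t w → (t , w) ∈ C → toℕ t < suc (toℕ t₀) →
               toℕ t ≤ toℕ t₀ × (t , w) ∈ facesOf y
      below′ t w ∈C t≤t₀ with ℕ.m≤n⇒m<n∨m≡n (s≤s⁻¹ t≤t₀)
      ... | inj₁ t<t₀ =
        let t≤s , w-v = below t w ∈C t<t₀
        in  ℕ.<⇒≤ t<t₀ , w-v ++ weaken (λ {c} → Above⊆Avoid t≤s {c}) v-y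
      ... | inj₂ t≡t₀ with refl ← toℕ-injective t≡t₀ =
        ℕ.≤-refl , proj₂ (⊑∧≡⇒≈ (chain-⊑ ∈C w₀∈C ℕ.≤-refl) refl) ++ reverse y-w₀

    incident : ∀ m → IncidentBelow m
    incident zero = record
      { s     = zero
      ; v     = vertex
      ; below = λ _ _ _ ()
      -- No colour has shifted rank 0, so connectedness gives the path.
      ; above = λ _ w _ _ → z≤n , w , connect (λ _ ()) , nil V.refl
      }
    incident (suc m) = incident-step (incident m)

    chain⊆facesOf : ∃[ v ] C ⊆ facesOf v
    chain⊆facesOf = v , λ {(t , w)} ∈C → proj₂ (below t w ∈C (toℕ<n t))
      where open IncidentBelow (incident (2 + n))

  base : (Φ : Flag facePoset) → ∃[ v ] faces Φ ≐ facesOf v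
  base Φ =
    let isChain , maximal = Flag.isMaximalChain Φ
        v , Φ⊆v = chain⊆facesOf isChain
    in  v , Φ⊆v , maximal (facesOf v) (facesOf-isChain v) Φ⊆v

  flaggedPoset : FlaggedPoset n ℓ
  flaggedPoset = record
    { poset            = facePoset
    ; least            = zero , vertex
    ; least-minimum    = λ (_ , w) → z≤n , w , connect (λ _ ()) , nil V.refl
    ; greatest         = fromℕ (suc n) , vertex
    ; greatest-maximum = λ (r , v) → subst (toℕ r ≤_) (sym (toℕ-fromℕ (suc n))) (s≤s⁻¹ (toℕ<n r)) ,
        v , nil V.refl , connect (λ c eq → ℕ.<⇒≢ (toℕ<n c) (ℕ.suc-injective (trans eq (toℕ-fromℕ (suc n)))))
    ; flag-cardinality = λ Φ → let v , Φ⊆v , v⊆Φ = base Φ in record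
      { to        = λ ((r , _) , _) → r
      ; from      = λ r → (r , v) , v⊆Φ (nil V.refl)
      ; to-cong   = proj₁
      ; from-cong = λ { refl → refl , nil V.refl }
      ; inverse   = proj₁ , λ { {(r , w) , w∈Φ} refl → refl , reverse (Φ⊆v w∈Φ) }
      }
    ; rank             = proj₁
    ; rank-cong        = proj₁
    ; rank-mono        = λ x⊑y x≉y →
        ℕ.≤∧≢⇒< (proj₁ x⊑y) (λ eq → x≉y (⊑∧≡⇒≈ x⊑y (toℕ-injective eq)))
    ; rank-onto        = λ r → (r , vertex) , refl
    }

  -- From the intersection condition to a polytope.

  module FacePolytope (intersection : PathIntersection G) where

    private
      variable
        x y v w : V.Carrier

    -- This is the intersection condition for the colours from `r` to `s` - 2: colour `c` has rank
    -- `c` + 1, so it is above `r` when `c` is at least `r` and below `s` when `c` is at most `s` -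
    -- 2. The other cases are those where a bound excludes every colour or none.
    above∩below : ∀ r s → Path (Above r) v w → Path (Below s) v w → Path (Above r ∩ Below s) v w
    above∩below r s α β with r ℕ.<? n | s
    ... | no r≮n  | _           = nil (empty-path (λ c r<c → r≮n (ℕ.<-≤-trans r<c (toℕ<n c))) α)
    ... | yes _   | zero        = nil (empty-path (λ _ ()) β)
    ... | yes _   | suc zero    = nil (empty-path (λ _ → λ { (s≤s ()) }) β)
    ... | yes r<n | suc (suc m) with m ℕ.<? n
    ...   | no m≮n  = weaken (λ {c} r<c → r<c , s≤s (s≤s (ℕ.≤-trans (ℕ.<⇒≤ (toℕ<n c)) (ℕ.≮⇒≥ m≮n)))) α
    ...   | yes m<n = weaken
      (λ { {c} (r≤c , c≤m) → s≤s (subst (_≤ toℕ c) r≡ r≤c) , s≤s (s≤s (subst (toℕ c ≤_) m≡ c≤m)) })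
      (intersection (fromℕ< r<n) (fromℕ< m<n) _ _
        (weaken (λ { {c} (s≤s (s≤s c≤m)) → z≤n , subst (toℕ c ≤_) (sym m≡) c≤m }) β)
        (weaken (λ {c} r<c → subst (_≤ toℕ c) (sym r≡) (s≤s⁻¹ r<c) , ℕ.∸-monoˡ-≤ 1 (toℕ<n c)) α))
      where
      r≡ = toℕ-fromℕ< r<n
      m≡ = toℕ-fromℕ< m<n

    module Separation {v w : V.Carrier} where

      -- The ranks at which the flags of `v` and `w` share their face.
      Common : Pred ℕ ℓ
      Common r = Path (Avoid r) v w

      AvoidCommon : ℕ → Pred (Fin n) ℓ
      AvoidCommon r c = ∀ s → s ∈ Common → s < r → c ∈ Avoid s

      extend : ∀ {r c} → c ∈ AvoidCommon r → (r ∈ Common → c ∈ Avoid r) → c ∈ AvoidCommon (suc r)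
      extend avoids new s common s≤r with ℕ.m≤n⇒m<n∨m≡n (s≤s⁻¹ s≤r)
      ... | inj₁ s<r  = avoids s common s<r
      ... | inj₂ refl = new common

      retract : ∀ {r c} → c ∈ AvoidCommon (suc r) → c ∈ AvoidCommon r
      retract avoids s common s<r = avoids s common (ℕ.m<n⇒m<1+n s<r)

      above-avoids : ∀ {r c} → c ∈ Above r → c ∈ AvoidCommon (suc r)
      above-avoids r<c s _ s≤r = Above⊆Avoid (s≤s⁻¹ s≤r) r<c

      -- As `r` is common, the path avoids it and can be sorted at `r`. Nothing more need be
      -- recorded for the second part: colours above `r` avoid all ranks up to `r`.
      split-at-common : ∀ {r x y} → r ∈ Common → Path (AvoidCommon (suc r)) x y →
                        ∃[ z ] (Path (AvoidCommon r ∩ Below r) x z × Path (Above r) z y)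
      split-at-common {r} common = split far cover
        where
        far : Far (AvoidCommon r ∩ Below r) (Above r)
        far {i} {j} (_ , i<r) r<j = Below-Far-Above r {i} {j} i<r r<j

        cover : ∀ c → c ∈ AvoidCommon (suc r) → c ∈ AvoidCommon r ∩ Below r ⊎ c ∈ Above r
        cover c avoids with Avoid⊆Below⊎Above r c (avoids r common ℕ.≤-refl)
        ... | inj₁ c<r = inj₁ (retract avoids , c<r)
        ... | inj₂ r<c = inj₂ r<c

      -- Only the largest common rank r below s matters: the part of the
      -- path above r is cut down to the colours below s.
      avoid∩below : ∀ r {s x y} → r ≤ s → Path (AvoidCommon r) x y → Path (Below s) x y →
                    Path (AvoidCommon r ∩ Below s) x y
      avoid∩below zero    r≤s α β = weaken (λ c<s → (λ _ _ ()) , c<s) β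
      avoid∩below (suc r) {s} r<s α β with em {r ∈ Common}
      ... | no ¬common = weaken
        (λ (avoids , c<s) → extend avoids (λ common → contradiction common ¬common) , c<s)
        (avoid∩below r (ℕ.<⇒≤ r<s) (weaken retract α) β)
      ... | yes common
        with z , x-z , z-y ← split-at-common common α
        = weaken (λ { {c} (avoids , c<r) → extend avoids (λ _ → ℕ.<⇒≢ c<r) , ℕ.<-trans c<r r<s }) x-z
          ++ weaken (λ { {c} (r<c , c<s) → above-avoids {c = c} r<c , c<s })
               -- Going back to `x` and then along `β` also joins `z` to `y` below `s`, so the
               -- intersection condition applies.
               (above∩below r s z-y
                 (reverse (weaken (λ {c} p → ℕ.<-trans (proj₂ p) r<s) x-z) ++ β))

      -- Induction on `r`. If `r` is common, some path runs below `r` from `v` to `y`, then above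
      -- `r` to `w`. The second part avoids all ranks up to `r`. For the first, `y` is also reached
      -- from `v` by way of `w` within `AvoidCommon r`, and `avoid∩below` combines the two routes.
      avoid-all : ∀ r → Path (AvoidCommon r) v w
      avoid-all zero = connect (λ _ _ _ ())
      avoid-all (suc r) with em {r ∈ Common}
      ... | no ¬common = weaken
        (λ avoids → extend avoids (λ common → contradiction common ¬common)) (avoid-all r)
      ... | yes common
        with y , v-y , y-w ← split-below-above r common
        = weaken (λ { {c} (avoids , c<r) → extend avoids (λ _ → ℕ.<⇒≢ c<r) })
            (avoid∩below r ℕ.≤-refl
              (avoid-all r ++ reverse (weaken (λ {c} r<c → retract (above-avoids {c = c} r<c)) y-w)) v-y)
          ++ weaken (λ {c} → above-avoids {c = c}) y-w

    separation : ∀ v w → Path (λ c → ¬ Path (Avoid (suc (toℕ c))) v w) v w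
    separation v w =
      -- The cutoff `suc n` exceeds the shifted rank of every colour.
      weaken (λ {c} avoids common → avoids (suc (toℕ c)) common (s≤s (toℕ<n c)) refl) (avoid-all (suc n))
      where open Separation

    -- When all faces are shared, no colour is left for the path given by `separation`.
    facesOf-injective : facesOf v ≐ facesOf w → v V.≈ w
    facesOf-injective {v} {w} (v⊆w , _) =
      empty-path (λ c → contradiction (common c)) (separation v w)
      where
      common : ∀ (c : Fin n) → Path (Avoid (suc (toℕ c))) v w
      common c = subst (λ r → Path (Avoid (suc r)) v w) (toℕ-inject₁ c)
                   (v⊆w {suc (inject₁ c) , v} (nil V.refl))

    open FlaggedPoset flaggedPoset using (Adjacent; FlagSequence; stop; step; _≐ᶠ_)

    dart-avoids : ∀ d r → r ≢ suc (inject₁ (colour d)) → Path (Avoid (toℕ r)) (init d) (term d)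
    dart-avoids d r r≢ =
      [ d ] (λ eq → r≢ (toℕ-injective (trans (sym eq) (cong suc (sym (toℕ-inject₁ (colour d)))))))

    adjacent-dart : ∀ d {Φ Ψ} → faces Φ ≐ facesOf (init d) → faces Ψ ≐ facesOf (term d) →
                    Adjacent (colour d) Φ Ψ
    adjacent-dart d (Φ⊆ , ⊆Φ) (Ψ⊆ , ⊆Ψ) =
      (λ (r , _) r≢ → mk⇔ (λ ∈Φ → ⊆Ψ (Φ⊆ ∈Φ ++ dart-avoids d r r≢))
                          (λ ∈Ψ → ⊆Φ (Ψ⊆ ∈Ψ ++ reverse (dart-avoids d r r≢)))) ,
      λ (Φ⊆Ψ , Ψ⊆Φ) → allLinks d (facesOf-injective ((Ψ⊆ ∘ Φ⊆Ψ ∘ ⊆Φ) , (Φ⊆ ∘ Ψ⊆Φ ∘ ⊆Ψ)))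

    -- A path of one colour runs back and forth along a single edge.
    monochromatic : ∀ {i} d → init d V.≈ x → colour d ≡ i → Path (_≡ i) x y → x V.≈ y ⊎ term d V.≈ y
    monochromatic d d-x cd (nil x≈y) = inj₁ x≈y
    monochromatic d d-x cd (cons e x≈ ce w)
      with monochromatic (inv e) (init-inv e) (trans (colour-inv e) ce) w
    ... | inj₁ e≈y  = inj₂ (V.trans (term-cong (dart-unique (V.trans d-x x≈) (trans cd (sym ce)))) e≈y)
    ... | inj₂ e⁻≈y = inj₁ (V.trans (V.trans x≈ (V.sym (term-inv e))) e⁻≈y)

    -- The two flags share all faces of rank other than that of `i`, so `separation` joins their
    -- vertices by colour `i` alone. The path ends at `init d` or `term d`, and the first would make
    -- the flags equal.
    adjacent⇒term : ∀ d {i} → colour d ≡ i → ∀ {Φ Ψ} → faces Φ ≐ facesOf (init d) →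
                    Adjacent i Φ Ψ → faces Ψ ≐ facesOf w → term d V.≈ w
    adjacent⇒term {w} d {i} cd {Φ} {Ψ} Φ≐d@(Φ⊆ , ⊆Φ) (agree , differ) Ψ≐w@(Ψ⊆ , ⊆Ψ) =
      [ (λ d≈w → contradiction (≐-trans Φ≐d (≐-trans (facesOf-cong d≈w) (≐-sym Ψ≐w))) differ)
      , id ]′ (monochromatic d V.refl cd (weaken only-i (separation (init d) w)))
      where
      only-i : ∀ {c} → ¬ Path (Avoid (suc (toℕ c))) (init d) w → c ≡ i
      only-i {c} separated = decidable-stable (c Fin.≟ i) λ c≢i → separated
        (subst (λ r → Path (Avoid (suc r)) (init d) w) (toℕ-inject₁ c)
          (Ψ⊆ (Equivalence.to (agree (suc (inject₁ c) , init d) (c≢i ∘ Fin.inject₁-injective ∘ Fin.suc-injective))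
            (⊆Φ (nil V.refl)))))

    -- Each dart crossed has a colour that is the rank of no face in `S`, so every flag on the way
    -- contains `S`.
    sequence : ∀ {S : Pred Face ℓ} {Φ Ψ} → faces Φ ≐ facesOf v → faces Ψ ≐ facesOf w → S ⊆ faces Φ →
               Path (λ c → ∀ {x} → x ∈ S → toℕ (proj₁ x) ≢ suc (toℕ c)) v w → FlagSequence S Φ Ψ
    sequence Φ≐ Ψ≐ S⊆Φ (nil v≈w) =
      stop S⊆Φ (≐-trans Φ≐ (≐-trans (facesOf-cong v≈w) (≐-sym Ψ≐)))
    sequence {v} {Φ = Φ} Φ≐ Ψ≐ S⊆Φ (cons d v≈ c∉S p) =
      step S⊆Φ (colour d , adjacent-dart d {Φ} {flag (term d)} Φ≐d (id , id))
        (sequence {Φ = flag (term d)} (id , id) Ψ≐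
          (λ { {r , _} ∈S → proj₁ Φ≐d (S⊆Φ ∈S) ++
               dart-avoids d r (λ r≡ → c∉S ∈S (trans (cong toℕ r≡) (cong suc (toℕ-inject₁ (colour d))))) })
          p)
      where
      Φ≐d : faces Φ ≐ facesOf (init d)
      Φ≐d = ≐-trans Φ≐ (facesOf-cong v≈)

    polytope : Polytope n ℓ
    polytope = record
      { flaggedPoset          = flaggedPoset
      ; diamond               = λ Φ i →
          let v , Φ≐v        = base Φ
              d , d≈v , d≡i  = coloured-dart v i
              Φ≐d            = ≐-trans Φ≐v (facesOf-cong (V.sym d≈v))
          in  flag (term d) ,
              subst (λ j → Adjacent j Φ (flag (term d))) d≡i
                (adjacent-dart d {Φ} {flag (term d)} Φ≐d (id , id)) ,
              λ {Ψ} adjacent →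
                let w , Ψ≐w = base Ψ
                    d≈w     = adjacent⇒term d d≡i {Φ} {Ψ} Φ≐d adjacent Ψ≐w
                in  ≐-trans (facesOf-cong d≈w) (≐-sym Ψ≐w)
      ; stronglyFlagConnected = λ Φ Ψ →
          let v , Φ≐v = base Φ
              w , Ψ≐w = base Ψ
          in  sequence {Φ = Φ} {Ψ} Φ≐v Ψ≐w proj₁
                -- The rank of a face common to `Φ` and `Ψ` is avoided by a path from `v` to `w`
                -- inside that face, so `separation` does not use its colour.
                (weaken (λ separated {x} (∈Φ , ∈Ψ) r≡ → separated
                          (subst (λ r → Path (Avoid r) v w) r≡ (reverse (proj₁ Φ≐v ∈Φ) ++ proj₁ Ψ≐w ∈Ψ)))
                        (separation v w))
      }

    private
      module F = Graph (flagGraph polytope)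

    isomorphism : ColouredIsomorphism G (flagGraph polytope)
    isomorphism = record
      { onVertices       = record
          { to        = flag
          ; from      = λ Φ → proj₁ (base Φ)
          ; to-cong   = facesOf-cong
          ; from-cong = λ {Φ} {Ψ} → from-cong {Φ} {Ψ}
          ; inverse   = (λ {Φ} eq → ≐-trans (facesOf-cong eq) (≐-sym (proj₂ (base Φ)))) ,
                        λ {v} {Φ} eq → facesOf-injective (≐-trans (≐-sym (proj₂ (base Φ))) eq)
          }
      ; onDarts          = record
          { to        = toDart
          ; from      = fromDart
          ; to-cong   = λ d≈e → colour-cong d≈e , facesOf-cong (init-cong d≈e) , facesOf-cong (term-cong d≈e)
          ; from-cong = λ {α} {β} → fromDart-cong α β
          ; inverse   = (λ {α} {d} d≈ → toDart-inverseˡ α d d≈) ,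
                        λ {d} {α} α≈ → toDart-inverseʳ d α α≈
          }
      ; init-preserved   = λ _ → id , id
      ; term-preserved   = λ _ → id , id
      ; inv-preserved    = λ d →
          sym (colour-inv d) , facesOf-cong (V.sym (init-inv d)) , facesOf-cong (V.sym (term-inv d))
      ; colour-preserved = λ _ → refl
      }
      where
      from-cong : ∀ {Φ Ψ} → faces Φ ≐ faces Ψ → proj₁ (base Φ) V.≈ proj₁ (base Ψ)
      from-cong {Φ} {Ψ} Φ≐Ψ =
        facesOf-injective (≐-trans (≐-sym (proj₂ (base Φ))) (≐-trans Φ≐Ψ (proj₂ (base Ψ))))

      toDart : D.Carrier → F.D.Carrier
      toDart d = (colour d , flag (init d) , flag (term d)) ,
                 adjacent-dart d {flag (init d)} {flag (term d)} (id , id) (id , id)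

      -- Initial flag and colour suffice to recover the dart; that its terminal flag is right
      -- follows from `adjacent⇒term`.
      dartOf : (α : F.D.Carrier) → ∃[ d ] (init d V.≈ proj₁ (base (F.init α)) × colour d ≡ F.colour α)
      dartOf α = coloured-dart (proj₁ (base (F.init α))) (F.colour α)

      fromDart : F.D.Carrier → D.Carrier
      fromDart = proj₁ ∘ dartOf

      fromDart-cong : ∀ α β → α F.D.≈ β → fromDart α D.≈ fromDart β
      fromDart-cong α@((i , Φ , _) , _) β@((j , Ψ , _) , _) (i≡j , Φ≐Ψ , _) =
        let _ , d≈ , cd = dartOf α
            _ , e≈ , ce = dartOf β
        in  dart-unique (V.trans d≈ (V.trans (from-cong {Φ} {Ψ} Φ≐Ψ) (V.sym e≈))) (trans cd (trans i≡j (sym ce)))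

      toDart-inverseˡ : ∀ α d → d D.≈ fromDart α → toDart d F.D.≈ α
      toDart-inverseˡ α@((i , Φ , Ψ) , adjacent) d d≈ =
        let e , e≈ , ce = dartOf α
            v , Φ≐v     = base Φ
            w , Ψ≐w     = base Ψ
            d≐Φ         = ≐-trans (facesOf-cong (V.trans (init-cong d≈) e≈)) (≐-sym Φ≐v)
            d≡i         = trans (colour-cong d≈) ce
        in  d≡i , d≐Φ ,
            ≐-trans (facesOf-cong (adjacent⇒term d d≡i {Φ} {Ψ} (≐-sym d≐Φ) adjacent Ψ≐w)) (≐-sym Ψ≐w)

      toDart-inverseʳ : ∀ d α → α F.D.≈ toDart d → fromDart α D.≈ d
      toDart-inverseʳ d α@((i , Φ , Ψ) , _) (i≡ , Φ≐ , _) =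
        let e , e≈ , ce = dartOf α
        in  dart-unique (V.trans e≈ (facesOf-injective (≐-trans (≐-sym (proj₂ (base Φ))) Φ≐))) (trans ce i≡)

    isFlagGraph : IsFlagGraphOfPolytope G
    isFlagGraph = polytope , isomorphism

-- The intersection condition in the flag graph of a polytope.

module PolytopeFlags (em : ExcludedMiddle ℓ) (𝒫 : Polytope n ℓ) where
  open Polytope 𝒫
  open Graph (flagGraph 𝒫) using (Path; nil; cons)

  private
    module P = Poset poset

    shift : Fin n → Fin (2 + n)
    shift i = suc (inject₁ i)

  chain-≈ : ∀ {C x y} → IsChain poset C → x ∈ C → y ∈ C → rank x ≡ rank y → x ≈ y
  chain-≈ {x = x} {y} C-chain x∈C y∈C eq with em {x ≈ y}
  ... | yes x≈y = x≈y
  ... | no x≉y with C-chain x∈C y∈C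
  ...   | inj₁ x⊑y = contradiction (rank-mono x⊑y x≉y) (ℕ.<-irrefl (cong toℕ eq))
  ...   | inj₂ y⊑x = contradiction (rank-mono y⊑x (x≉y ∘ P.Eq.sym)) (ℕ.<-irrefl (cong toℕ (sym eq)))

  faces-resp : ∀ (Φ : Flag poset) {x y} → x ≈ y → x ∈ faces Φ → y ∈ faces Φ
  faces-resp Φ x≈y x∈Φ =
    let isChain , maximal = Flag.isMaximalChain Φ
    in  maximal (λ z → ∃[ c ] (c ∈ faces Φ × c ≈ z))
          (λ { (c , c∈Φ , c≈) (d , d∈Φ , d≈) →
               [ inj₁ ∘ P.≤-respʳ-≈ d≈ ∘ P.≤-respˡ-≈ c≈ , inj₂ ∘ P.≤-respʳ-≈ c≈ ∘ P.≤-respˡ-≈ d≈ ]′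
                 (isChain c∈Φ d∈Φ) })
          (λ z∈Φ → _ , z∈Φ , P.Eq.refl)
          (_ , x∈Φ , x≈y)

  face-of-rank : ∀ (Φ : Flag poset) r → ∃[ x ] (x ∈ faces Φ × rank x ≡ r)
  face-of-rank Φ r =
    let open Inverse (flag-cardinality Φ)
        j , eq = injective⇒surjective (rank ∘ proj₁ ∘ from)
                   (λ {j} {k} eq → trans (sym (strictlyInverseˡ j)) (trans
                      (to-cong (chain-≈ (proj₁ (Flag.isMaximalChain Φ)) (proj₂ (from j)) (proj₂ (from k)) eq))
                      (strictlyInverseˡ k)))
                   r
    in  proj₁ (from j) , proj₂ (from j) , eq

  path-agrees : ∀ {I : Pred (Fin n) p} {Φ Ψ} → Path I Φ Ψ → ∀ {x} →
                (∀ {i} → i ∈ I → rank x ≢ shift i) → x ∈ faces Φ → x ∈ faces Ψ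
  path-agrees (nil (Φ⊆Ψ , _)) r∉I = Φ⊆Ψ
  path-agrees (cons (_ , agree , _) (Φ⊆d , _) i∈I w) r∉I =
    path-agrees w r∉I ∘ Equivalence.to (agree _ (r∉I i∈I)) ∘ Φ⊆d

  sequence-start : ∀ {S Φ Ψ} → FlagSequence S Φ Ψ → S ⊆ faces Φ
  sequence-start (stop S⊆Φ _)   = S⊆Φ
  sequence-start (step S⊆Φ _ _) = S⊆Φ

  -- Adjacent flags agree off rank `i`, and a chain has at most one face of each rank, so sharing a
  -- face of rank `i` would make them equal.
  ¬adjacent-at-common-face : ∀ {i Φ Ψ x} → Adjacent i Φ Ψ → rank x ≡ shift i →
                             x ∈ faces Φ → ¬ x ∈ faces Ψ
  ¬adjacent-at-common-face {i} {Φ} {Ψ} {x} (agree , differ) x-rank x∈Φ x∈Ψ = differ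
    ( included Φ Ψ x∈Φ x∈Ψ (λ y r → Equivalence.to (agree y r))
    , included Ψ Φ x∈Ψ x∈Φ (λ y r → Equivalence.from (agree y r)))
    where
    included : ∀ (Φ Ψ : Flag poset) → x ∈ faces Φ → x ∈ faces Ψ →
               (∀ y → rank y ≢ shift i → y ∈ faces Φ → y ∈ faces Ψ) → faces Φ ⊆ faces Ψ
    included Φ Ψ x∈Φ x∈Ψ agree {y} y∈Φ with rank y Fin.≟ shift i
    ... | no r≢  = agree y r≢ y∈Φ
    ... | yes r≡ = faces-resp Ψ
      (chain-≈ (proj₁ (Flag.isMaximalChain Φ)) x∈Φ y∈Φ (trans x-rank (sym r≡))) x∈Ψ

  sequence⇒path : ∀ {I : Pred (Fin n) p} {S Φ Ψ} → (∀ i → Dec (i ∈ I)) →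
                  (∀ i → ¬ i ∈ I → ∃[ x ] (x ∈ S × rank x ≡ shift i)) →
                  FlagSequence S Φ Ψ → Path I Φ Ψ
  sequence⇒path I? fixed (stop _ Φ≐Ψ) = nil Φ≐Ψ
  sequence⇒path I? fixed (step {Φ} {Φ′} S⊆Φ (i , adjacent) s) with I? i
  ... | yes i∈I = cons ((i , Φ , Φ′) , adjacent) (id , id) i∈I (sequence⇒path I? fixed s)
  ... | no i∉I  =
    let x , x∈S , x-rank = fixed i i∉I
    in  contradiction (sequence-start s x∈S)
          (¬adjacent-at-common-face {Φ = Φ} {Φ′} adjacent x-rank (S⊆Φ x∈S))

  intersection : PathIntersection (flagGraph 𝒫)
  intersection k m Φ Ψ α β = sequence⇒path [k⋯m]? fixed (stronglyFlagConnected Φ Ψ)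
    where
    [k⋯m]? : ∀ i → Dec (i ∈ [ toℕ k ⋯ toℕ m ])
    [k⋯m]? i = toℕ k ℕ.≤? toℕ i ×-dec toℕ i ℕ.≤? toℕ m

    shift-≢ : ∀ {I : Pred (Fin n) p} {i x} → ¬ i ∈ I → rank x ≡ shift i →
              ∀ {j} → j ∈ I → rank x ≢ shift j
    shift-≢ {I = I} i∉I r≡ j∈I r≡′ =
      i∉I (subst I (Fin.inject₁-injective (Fin.suc-injective (trans (sym r≡′) r≡))) j∈I)

    -- A colour outside the interval is below `k`, and then `β` never changes the face of its rank,
    -- or above `m`, and then `α` never does.
    fixed : ∀ i → ¬ i ∈ [ toℕ k ⋯ toℕ m ] → ∃[ x ] (x ∈ faces Φ ∩ faces Ψ × rank x ≡ shift i)
    fixed i i∉ with face-of-rank Φ (shift i) | toℕ i ℕ.≤? toℕ m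
    ... | x , x∈Φ , r≡ | yes i≤m =
      x , (x∈Φ , path-agrees β (shift-≢ {I = [ toℕ k ⋯ n ∸ 1 ]} (λ (k≤i , _) → i∉ (k≤i , i≤m)) r≡) x∈Φ) , r≡
    ... | x , x∈Φ , r≡ | no i≰m  =
      x , (x∈Φ , path-agrees α (shift-≢ {I = [ 0 ⋯ toℕ m ]} (i≰m ∘ proj₂) r≡) x∈Φ) , r≡

-- Paths of the derived graph as paths with prescribed voltage.

module Derived {X : Graph n ℓ ℓ} (Γ : Group ℓ ℓ) (ξ : VoltageAssignment X Γ) where
  open Graph X
  open VoltageAssignment ξ
  private
    module Γ = Group Γ
    module X^ξ = Graph (derivedGraph X Γ ξ)
    open Paths X using (Path-respˡ)

    variable
      I : Pred (Fin n) p
      x y : V.Carrier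
      g h : Γ.Carrier

  lift : (w : Path I x y) → pathVoltage w Γ.∙ g Γ.≈ h → X^ξ.Path I (x , g) (y , h)
  lift         (nil x≈y)       eq = X^ξ.nil (x≈y , Γ.trans (Γ.sym (Γ.identityˡ _)) eq)
  lift {g = g} (cons d x≈ i w) eq =
    X^ξ.cons (d , g) (x≈ , Γ.refl) i (lift w (Γ.trans (Γ.sym (Γ.assoc _ _ _)) eq))

  project : X^ξ.Path I (x , g) (y , h) → Σ (Path I x y) λ w → pathVoltage w Γ.∙ g Γ.≈ h
  project (X^ξ.nil (x≈y , g≈h)) = nil x≈y , Γ.trans (Γ.identityˡ _) g≈h
  project (X^ξ.cons (d , g′) (x≈ , g≈g′) i u) =
    let w , eq = project u
    in  cons d x≈ i w , Γ.trans (Γ.∙-congˡ g≈g′) (Γ.trans (Γ.assoc _ _ _) eq)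

  VoltageIntersection : Set _
  VoltageIntersection = ∀ (k m : Fin n) x y →
    (Voltages [ 0 ⋯ toℕ m ] x y ∩ Voltages [ toℕ k ⋯ n ∸ 1 ] x y) ≐ Voltages [ toℕ k ⋯ toℕ m ] x y

  pathVoltage-weaken : {J : Pred (Fin n) q} (I⊆J : I ⊆ J) (w : Path I x y) →
                       pathVoltage (Paths.weaken X I⊆J w) ≡ pathVoltage w
  pathVoltage-weaken I⊆J (nil _)        = refl
  pathVoltage-weaken I⊆J (cons d _ _ w) = cong (Γ._∙ voltage d) (pathVoltage-weaken I⊆J w)

  Voltages-mono : {J : Pred (Fin n) q} → I ⊆ J → Voltages I x y ⊆ Voltages J x y
  Voltages-mono I⊆J (w , eq) = Paths.weaken X I⊆J w , Γ.trans (Γ.reflexive (pathVoltage-weaken I⊆J w)) eq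

  intersections-correspond : PathIntersection (derivedGraph X Γ ξ) ⇔ VoltageIntersection
  intersections-correspond = mk⇔
    (λ paths k m x y →
      (λ { {g} ((v , v-g) , (w , w-g)) →
           -- Started at the identity, a lifted path ends over its own voltage.
           let u , u-g = project (paths k m (x , Γ.ε) (y , g)
                           (lift v (Γ.trans (Γ.identityʳ _) v-g)) (lift w (Γ.trans (Γ.identityʳ _) w-g)))
           in  u , Γ.trans (Γ.sym (Γ.identityʳ _)) u-g }) ,
      λ {g} ∈V → Voltages-mono (λ (_ , c≤m) → z≤n , c≤m) ∈V ,
                 Voltages-mono (λ {c} (k≤c , _) → k≤c , ℕ.∸-monoˡ-≤ 1 (toℕ<n c)) ∈V)
    (λ voltages k m (x , g) (y , h) α β →
      let u , u-h = proj₁ (voltages k m x y) (quotient (project α) , quotient (project β))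
      in  lift u (Γ.trans (Γ.∙-congʳ u-h) (//-rightDividesˡ g h)))
    where
    open GroupProperties Γ using (//-rightDividesˡ; //-rightDividesʳ)

    -- The voltage depends only on the ends of the lifted path, so `α` and `β` give the same element
    -- of the intersection.
    quotient : (Σ (Path I x y) λ w → pathVoltage w Γ.∙ g Γ.≈ h) → (h Γ.∙ g Γ.⁻¹) ∈ Voltages I x y
    quotient {g = g} (w , eq) = w , Γ.trans (Γ.sym (//-rightDividesʳ g _)) (Γ.∙-congʳ eq)

-- The equivalence for maniplexes and for derived graphs.

isFlagGraph⇔pathIntersection : ExcludedMiddle ℓ → {G : Graph n ℓ ℓ} → IsManiplex G →
                               IsFlagGraphOfPolytope G ⇔ PathIntersection G
isFlagGraph⇔pathIntersection em {G} maniplex = mk⇔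
  (λ (𝒫 , iso) k m v w α β →
    let open ColouredIsomorphism iso using (vertexMap)
        open Isomorphisms iso
        H = flagGraph 𝒫
    in  reflects-path (PolytopeFlags.intersection em 𝒫 k m _ _ (preserves-path α) (preserves-path β))
          (Graph.V.refl H {vertexMap v}) (Graph.V.refl H {vertexMap w}))
  (FacePoset.FacePolytope.isFlagGraph maniplex em)

theorem4p2 : ∀ {ℓ : Level} → ExcludedMiddle ℓ →
    ∀ (n : ℕ) (X : Graph n ℓ ℓ) → IsPremaniplex X →
    ∀ (Γ : Group ℓ ℓ) (ξ : VoltageAssignment X Γ) →
    IsManiplex (derivedGraph X Γ ξ) →
    let open Graph X using (module V)
        open VoltageAssignment ξ using (Voltages)
    in  IsFlagGraphOfPolytope (derivedGraph X Γ ξ) ⇔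
        (∀ (k m : Fin n) (x y : V.Carrier) →
          (Voltages [ 0 ⋯ toℕ m ] x y ∩ Voltages [ toℕ k ⋯ n ∸ 1 ] x y)
          ≐ Voltages [ toℕ k ⋯ toℕ m ] x y)
theorem4p2 em n X _ Γ ξ maniplex =
  ⇔.trans (isFlagGraph⇔pathIntersection em maniplex) (Derived.intersections-correspond Γ ξ)
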